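{- Every oriented ray with an unbounded representing sequence is not ubiquitous.
   Context: An oriented ray is a digraph whose underlying undirected graph is a ray (one-way infinite path) with first vertex the unique vertex of undirected degree $1$. An arc is in-oriented if it points towards the first vertex and out-oriented otherwise. A phase is a maximal consistently directed path (dipath) contained in the ray; its length is its number of arcs. For an oriented ray with infinitely many in-oriented and infinitely many out-oriented arcs, its representing sequence is the sequence whose $n$-th term is the length of the $n$-th phase, counted from the first vertex; it is unbounded if no $b\in\mathbb N$ bounds all its terms. A digraph $H$ is ubiquitous if every digraph which, for every $k\in\mathbb N$, contains $k$ pairwise vertex-disjoint subdigraphs isomorphic to $H$ also contains infinitely many pairwise vertex-disjoint subdigraphs isomorphic to $H$. -}

module Defs where

open import Data.Nat using (ℕ; zero; suc; _+_; _≤_; _<_)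
open import Data.Bool using (Bool; true; false)
open import Data.Fin using (Fin)
open import Data.Product using (Σ; _×_; ∃)
open import Data.Sum using (_⊎_)
open import Relation.Binary.PropositionalEquality using (_≡_; _≢_)
open import Relation.Nullary using (¬_)

record Digraph : Set₁ where
  field
    V : Set
    E : V → V → Set
open Digraph public

-- G contains a subdigraph isomorphic to H  ⇔  there is an injective
-- arc-preserving map V H → V G (its image, with the image arcs, is the copy).
record Copy (H G : Digraph) : Set where
  field
    map : V H → V G
    inj : ∀ x y → map x ≡ map y → x ≡ y
    hom : ∀ x y → E H x y → E G (map x) (map y)
open Copy public

HasDisjointCopies : ℕ → Digraph → Digraph → Set
HasDisjointCopies k H G =
  Σ (Fin k → Copy H G) λ F →
    ∀ i j → i ≢ j → ∀ x y → map (F i) x ≢ map (F j) y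

HasInfinitelyManyDisjointCopies : Digraph → Digraph → Set
HasInfinitelyManyDisjointCopies H G =
  Σ (ℕ → Copy H G) λ F →
    ∀ i j → i ≢ j → ∀ x y → map (F i) x ≢ map (F j) y

Ubiquitous : Digraph → Set₁
Ubiquitous H = (G : Digraph) →
  (∀ k → HasDisjointCopies k H G) → HasInfinitelyManyDisjointCopies H G

-- Oriented rays.  Vertices are ℕ (vertex 0 is the first vertex); the n-th arc
-- joins n and n+1, and d n = true means it is out-oriented (n → n+1),
-- d n = false means it is in-oriented (n+1 → n).
RayArc : (ℕ → Bool) → ℕ → ℕ → Set
RayArc d m n = (n ≡ suc m × d m ≡ true) ⊎ (m ≡ suc n × d n ≡ false)

OrientedRay : (ℕ → Bool) → Digraph
OrientedRay d = record { V = ℕ ; E = RayArc d }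

InfinitelyManyOut : (ℕ → Bool) → Set
InfinitelyManyOut d = ∀ n → ∃ λ m → n ≤ m × d m ≡ true

InfinitelyManyIn : (ℕ → Bool) → Set
InfinitelyManyIn d = ∀ n → ∃ λ m → n ≤ m × d m ≡ false

-- IsPhase d a l : the arcs a, a+1, …, a+l-1 form a phase (maximal dipath)
-- of length l ≥ 1, i.e. the dipath from vertex a to vertex a+l.
IsPhase : (ℕ → Bool) → ℕ → ℕ → Set
IsPhase d a l =
  (1 ≤ l) ×
  (∀ i → i < l → d (a + i) ≡ d a) ×
  (a ≡ 0 ⊎ Σ ℕ (λ a' → (a ≡ suc a') × (d a' ≢ d a))) ×
  (d (a + l) ≢ d a)

-- The terms of the representing sequence are exactly the lengths of the
-- phases; it is unbounded iff no b bounds all of them.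
RepresentingSequenceUnbounded : (ℕ → Bool) → Set
RepresentingSequenceUnbounded d =
  ∀ (b : ℕ) → ¬ (∀ a l → IsPhase d a l → l ≤ b)

{-# OPTIONS --safe #-}
module Submission where

-- Let the host be a union of rays R(k,i), all copies of the given ray, in which
-- R(k,0), …, R(k,k-1) are pairwise disjoint while any other two rays share
-- vertices infinitely often.  A shared vertex lies close to the end of a very
-- long phase, one step further along on one ray than on the other, so a path
-- that switches rays there makes a phase whose length is off by one.
--
-- Every copy P of the ray in the host eventually runs along one R(k,i), with
-- vertex n of P at vertex n of R(k,i).  Only shared vertices let P gain on the
-- vertex numbering, and at most by one each, so P cannot run far ahead of its
-- own numbering.  On the other hand a phase carrying shared vertices is a record
-- and exceeds its predecessors of that kind by at least two, so P has to map a
-- late one onto the same phase of some R(k,i), and from there on it can neither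
-- turn back nor switch.
--
-- Given infinitely many disjoint copies, let the first one end up on R(k,i).
-- All others must then end up on the rays R(k,0), …, R(k,k-1), and no two on the
-- same one, so there are at most k others.
--
-- Since the phase lengths are only known not to be bounded, long phases exist in
-- the double-negated sense only.  The host therefore never searches for one: it
-- recognises a shared vertex from the arcs up to the end of the phase.

open import Defs
open import Data.Bool using (Bool; true; false; if_then_else_)
import Data.Bool.Properties as Bool
open import Data.Empty using (⊥; ⊥-elim)
open import Data.Fin using (Fin; toℕ; fromℕ<) renaming (zero to fzero; suc to fsuc; _<_ to _<ᶠ_)
open import Data.Fin.Properties using (toℕ-injective; toℕ<n; pigeonhole; fromℕ<-injective)
open import Data.Nat using (ℕ; zero; suc; _+_; _∸_; _≤_; _<_; _⊔_; z≤n; s≤s; _≤?_; _<?_; pred; >-nonZero)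
open import Data.Nat.Properties
open import Data.Product using (∃; ∃₂; _×_; _,_; proj₁; proj₂)
open import Data.Product.Properties using (≡-dec)
open import Data.Sum using (_⊎_; inj₁; inj₂)
open import Function using (_∘_)
open import Relation.Binary.PropositionalEquality
open import Relation.Nullary using (¬_; Dec; yes; no; does; contradiction)
open import Relation.Nullary.Decidable using (_×-dec_; ¬?; dec-true; dec-false)

-- Double negation passes through finite conjunctions, so the double-negated tails of finitely many
-- copies can be assumed together.
¬¬-Π-Fin : ∀ {n} {Q : Fin n → Set} → (∀ i → ¬ ¬ Q i) → ¬ ¬ (∀ i → Q i)
¬¬-Π-Fin {zero} _ k = k λ ()
¬¬-Π-Fin {suc n} h k =
  h fzero λ q₀ → ¬¬-Π-Fin (h ∘ fsuc) λ qs → k λ { fzero → q₀ ; (fsuc i) → qs i }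

slow-growth : (g : ℕ → ℕ) → (∀ n → g (suc n) ≤ suc (g n)) → ∀ {i j} → i ≤ j → i + g j ≤ j + g i
slow-growth g slow {i} i≤j with m≤n⇒∃[o]m+o≡n i≤j
... | k , refl = go k
  where
  go : ∀ k → i + g (i + k) ≤ i + k + g i
  go zero rewrite +-identityʳ i = ≤-refl
  go (suc k) rewrite +-suc i k = begin
    i + g (suc (i + k))  ≤⟨ +-monoʳ-≤ i (slow (i + k)) ⟩
    i + suc (g (i + k))  ≡⟨ +-suc i _ ⟩
    suc (i + g (i + k))  ≤⟨ s≤s (go k) ⟩
    suc (i + k + g i)    ∎
    where open ≤-Reasoning

suc-monotone : (g : ℕ → ℕ) → (∀ n → g n ≤ g (suc n)) → ∀ {i j} → i ≤ j → g i ≤ g j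
suc-monotone g mono {i} i≤j with m≤n⇒∃[o]m+o≡n i≤j
... | k , refl = go k
  where
  go : ∀ k → g i ≤ g (i + k)
  go zero rewrite +-identityʳ i = ≤-refl
  go (suc k) rewrite +-suc i k = ≤-trans (go k) (mono (i + k))

-- Enumerating pairs of rays, each infinitely often.

nextPair : ℕ × ℕ → ℕ × ℕ
nextPair (x , zero) = zero , suc x
nextPair (x , suc y) = suc x , y

pair : ℕ → ℕ × ℕ
pair zero = zero , zero
pair (suc n) = nextPair (pair n)

pair-slide : ∀ x y n → pair n ≡ (zero , x + y) → ∃ λ m → pair m ≡ (x , y)
pair-slide zero y n eq = n , eq
pair-slide (suc x) y n eq with pair-slide x (suc y) n (trans eq (cong (zero ,_) (sym (+-suc x y))))
... | m , e = suc m , cong nextPair e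

pair-diagonal : ∀ s → ∃ λ n → pair n ≡ (zero , s)
pair-diagonal zero = zero , refl
pair-diagonal (suc s) with pair-diagonal s
... | n , e with pair-slide s zero n (trans e (cong (zero ,_) (sym (+-identityʳ s))))
... | m , e′ = suc m , cong nextPair e′

pair-surjective : ∀ z → ∃ λ n → pair n ≡ z
pair-surjective (x , y) = pair-slide x y (proj₁ diagonal) (proj₂ diagonal)
  where
  diagonal : ∃ λ n → pair n ≡ (zero , x + y)
  diagonal = pair-diagonal (x + y)

nextPair-sum : ∀ z → proj₁ (nextPair z) + proj₂ (nextPair z) ≤ suc (proj₁ z + proj₂ z)
nextPair-sum (x , zero) = s≤s (≤-reflexive (sym (+-identityʳ x)))
nextPair-sum (x , suc y) = s≤s (+-monoʳ-≤ x (n≤1+n y))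

pair-sum : ∀ n → proj₁ (pair n) + proj₂ (pair n) ≤ n
pair-sum zero = z≤n
pair-sum (suc n) = ≤-trans (nextPair-sum (pair n)) (s≤s (pair-sum n))

Index : Set
Index = ℕ × ℕ

indexPair : ℕ → Index × Index
indexPair s = pair (proj₁ (pair (proj₁ (pair s)))) , pair (proj₂ (pair (proj₁ (pair s))))

-- `indexPair` ignores the second component of `pair s`, so this component is free to be `N`, and
-- `pair-sum` then forces `N ≤ s`.
indexPair-recurs : ∀ u t N → ∃ λ s → N ≤ s × indexPair s ≡ (u , t)
indexPair-recurs u t N
  with pair-surjective u | pair-surjective t
... | y , ey | z , ez with pair-surjective (y , z)
... | x , ex with pair-surjective (x , N)
... | s , es =
  s , subst (_≤ s) (cong proj₂ es) (≤-trans (m≤n+m _ (proj₁ (pair s))) (pair-sum s)) , eq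
  where
  eq : indexPair s ≡ (u , t)
  eq rewrite es | ex | ey | ez = refl

-- The pairs of rays that are to share vertices: all but those from the same
-- block R(k,0), …, R(k,k-1).
Clash : Index → Index → Set
Clash u t = u ≢ t × ¬ (proj₁ u ≡ proj₁ t × proj₂ u < proj₁ u × proj₂ t < proj₁ t)

clash? : ∀ u t → Dec (Clash u t)
clash? u t =
  ¬? (≡-dec _≟_ _≟_ u t) ×-dec
  ¬? ((proj₁ u ≟ proj₁ t) ×-dec ((proj₂ u <? proj₁ u) ×-dec (proj₂ t <? proj₁ t)))

-- Runs and phases of the orientation sequence.

module Construction (d : ℕ → Bool) where

  -- The number of arcs of the phase of arc n up to and including n.
  run : ℕ → ℕ
  run zero = 1
  run (suc n) = if does (d (suc n) Bool.≟ d n) then suc (run n) else 1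

  run-same : ∀ {n} → d (suc n) ≡ d n → run (suc n) ≡ suc (run n)
  run-same {n} e rewrite dec-true (d (suc n) Bool.≟ d n) e = refl

  run-diff : ∀ {n} → d (suc n) ≢ d n → run (suc n) ≡ 1
  run-diff {n} e rewrite dec-false (d (suc n) Bool.≟ d n) e = refl

  run-positive : ∀ n → 1 ≤ run n
  run-positive zero = ≤-refl
  run-positive (suc n) with d (suc n) Bool.≟ d n
  ... | yes e = s≤s z≤n
  ... | no e = ≤-refl

  run-suc-≤ : ∀ n → run (suc n) ≤ suc (run n)
  run-suc-≤ n with d (suc n) Bool.≟ d n
  ... | yes e = ≤-refl
  ... | no e = s≤s z≤n

  run-grows : ∀ {n} → 2 ≤ run (suc n) → d n ≡ d (suc n) × run (suc n) ≡ suc (run n)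
  run-grows {n} h with d (suc n) Bool.≟ d n
  ... | yes e = sym e , refl
  ... | no e = contradiction h λ { (s≤s ()) }

  run-antitone : ∀ {i j} → i ≤ j → i + run j ≤ j + run i
  run-antitone = slow-growth run run-suc-≤

  -- The length of the longest phase that ends before the phase of arc n starts.
  completed : ℕ → ℕ
  completed zero = 0
  completed (suc n) = if does (d (suc n) Bool.≟ d n) then completed n else completed n ⊔ run n

  completed-diff : ∀ {n} → d (suc n) ≢ d n → completed (suc n) ≡ completed n ⊔ run n
  completed-diff {n} e rewrite dec-false (d (suc n) Bool.≟ d n) e = refl

  completed-suc : ∀ n → completed n ≤ completed (suc n)
  completed-suc n with d (suc n) Bool.≟ d n
  ... | yes e = ≤-refl
  ... | no e = m≤m⊔n _ _

  record Phase (f : ℕ) : Set where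
    field
      first   : ℕ
      first≤  : first ≤ f
      length≡ : first + run f ≡ suc f
      dir     : ∀ {j} → first ≤ j → j ≤ f → d j ≡ d f
      run≡    : ∀ {j} → first ≤ j → j ≤ f → first + run j ≡ suc j
      earlier : ∀ {j} → j < first → run j ≤ completed f
      turn    : ∀ {b} → first ≡ suc b → d b ≢ d first

  phase : ∀ f → Phase f
  phase zero = record
    { first = 0 ; first≤ = z≤n ; length≡ = refl ; dir = λ { _ z≤n → refl }
    ; run≡ = λ { _ z≤n → refl } ; earlier = λ () ; turn = λ () }
  phase (suc f) with d (suc f) Bool.≟ d f
  ... | yes e = record
    { first = first ; first≤ = m≤n⇒m≤1+n first≤ ; length≡ = len
    ; dir = λ {j} s≤j j≤ → dir′ s≤j (m≤n⇒m<n∨m≡n j≤)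
    ; run≡ = λ {j} s≤j j≤ → run′ s≤j (m≤n⇒m<n∨m≡n j≤)
    ; earlier = λ h → ≤-trans (earlier h) (completed-suc f)
    ; turn = turn }
    where
    open Phase (phase f)
    len : first + run (suc f) ≡ suc (suc f)
    len = trans (cong (first +_) (run-same e)) (trans (+-suc first _) (cong suc length≡))
    dir′ : ∀ {j} → first ≤ j → j < suc f ⊎ j ≡ suc f → d j ≡ d (suc f)
    dir′ s≤j (inj₁ (s≤s j≤f)) = trans (dir s≤j j≤f) (sym e)
    dir′ s≤j (inj₂ refl) = refl
    run′ : ∀ {j} → first ≤ j → j < suc f ⊎ j ≡ suc f → first + run j ≡ suc j
    run′ s≤j (inj₁ (s≤s j≤f)) = run≡ s≤j j≤f
    run′ s≤j (inj₂ refl) = len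
  ... | no e = record
    { first = suc f ; first≤ = ≤-refl ; length≡ = run′ refl
    ; dir = λ s≤j j≤ → cong d (≤-antisym j≤ s≤j)
    ; run≡ = λ s≤j j≤ → run′ (≤-antisym j≤ s≤j)
    ; earlier = λ { (s≤s j≤f) → subst (_ ≤_) (sym (completed-diff e)) (early j≤f) }
    ; turn = λ { refl d≡ → e (sym d≡) } }
    where
    open Phase (phase f)
    run′ : ∀ {j} → j ≡ suc f → suc f + run j ≡ suc j
    run′ refl = trans (cong (suc f +_) (run-diff e)) (+-comm (suc f) 1)
    early : ∀ {j} → j ≤ f → run j ≤ completed f ⊔ run f
    early {j} j≤f with first ≤? j
    ... | yes s≤j = m≤n⇒m≤o⊔n _ (+-cancelˡ-≤ first _ _
            (subst₂ _≤_ (sym (run≡ s≤j j≤f)) (sym length≡) (s≤s j≤f)))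
    ... | no s≰j = m≤n⇒m≤n⊔o _ (earlier (≰⇒> s≰j))

  -- Sites: the ends of record phases.

  -- Arc suc n is the last one of a phase that is strictly longer than every
  -- earlier phase and longer by two than α, the length of the last chosen phase.
  SiteAbove : ℕ → ℕ → Set
  SiteAbove α n =
    d (suc n) ≢ d (suc (suc n)) × completed (suc n) < run (suc n) × suc (suc α) ≤ run (suc n)

  siteAbove? : ∀ α n → Dec (SiteAbove α n)
  siteAbove? α n =
    ¬? (d (suc n) Bool.≟ d (suc (suc n))) ×-dec
    ((completed (suc n) <? run (suc n)) ×-dec (suc (suc α) ≤? run (suc n)))

  lastSite : ℕ → ℕ
  -- The value 1 forces chosen phases to have at least three arcs.
  lastSite zero = 1
  lastSite (suc n) = if does (siteAbove? (lastSite n) n) then run (suc n) else lastSite n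

  -- Here `n` is the smaller of the two numbers that a shared vertex gets: two arcs of the phase
  -- follow it on one ray, one on the other.
  Site : ℕ → Set
  Site n = SiteAbove (lastSite n) n

  site? : ∀ n → Dec (Site n)
  site? n = siteAbove? (lastSite n) n

  count : ℕ → ℕ
  count zero = 0
  count (suc n) = if does (site? n) then suc (count n) else count n

  lastSite-site : ∀ {n} → Site n → lastSite (suc n) ≡ run (suc n)
  lastSite-site {n} s rewrite dec-true (site? n) s = refl

  lastSite-nonsite : ∀ {n} → ¬ Site n → lastSite (suc n) ≡ lastSite n
  lastSite-nonsite {n} s rewrite dec-false (site? n) s = refl

  count-site : ∀ {n} → Site n → count (suc n) ≡ suc (count n)
  count-site {n} s rewrite dec-true (site? n) s = refl

  count-nonsite : ∀ {n} → ¬ Site n → count (suc n) ≡ count n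
  count-nonsite {n} s rewrite dec-false (site? n) s = refl

  lastSite-suc : ∀ n → lastSite n ≤ lastSite (suc n)
  lastSite-suc n with site? n
  ... | yes s@(_ , _ , h) = subst (lastSite n ≤_) (sym (lastSite-site s)) (≤-trans (m≤n+m _ 2) h)
  ... | no s = ≤-reflexive (sym (lastSite-nonsite s))

  lastSite-mono : ∀ {m n} → m ≤ n → lastSite m ≤ lastSite n
  lastSite-mono = suc-monotone lastSite lastSite-suc

  lastSite-positive : ∀ n → 1 ≤ lastSite n
  lastSite-positive n = lastSite-mono {0} {n} z≤n

  -- Each chosen phase exceeds the previous one by at least two. Late chosen phases thus outweigh
  -- the lead of a path over its own numbering, which `count` bounds up to a constant.
  count-lastSite : ∀ n → suc (count n + count n) ≤ lastSite n
  count-lastSite zero = ≤-refl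
  count-lastSite (suc n) with site? n
  ... | no s rewrite count-nonsite s | lastSite-nonsite s = count-lastSite n
  ... | yes s@(_ , _ , h) rewrite count-site s | lastSite-site s | +-suc (count n) (count n) =
    ≤-trans (s≤s (s≤s (count-lastSite n))) h

  count-suc-≤ : ∀ n → count (suc n) ≤ suc (count n)
  count-suc-≤ n with site? n
  ... | yes s = ≤-reflexive (count-site s)
  ... | no s = m≤n⇒m≤1+n (≤-reflexive (count-nonsite s))

  count-≤-suc : ∀ n → count n ≤ count (suc n)
  count-≤-suc n with site? n
  ... | yes s = subst (count n ≤_) (sym (count-site s)) (n≤1+n _)
  ... | no s = ≤-reflexive (sym (count-nonsite s))

  count-antitone : ∀ {i j} → i ≤ j → i + count j ≤ j + count i
  count-antitone = slow-growth count count-suc-≤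

  count≤ : ∀ n → count n ≤ n
  count≤ n = ≤-trans (count-antitone {0} {n} z≤n) (≤-reflexive (+-identityʳ n))

  count-positive : ∀ n → 1 ≤ count n → ∃ λ m → m < n × Site m
  count-positive (suc n) h with site? n
  ... | yes s = n , ≤-refl , s
  ... | no s′ with count-positive n (subst (1 ≤_) (count-nonsite s′) h)
  ... | m , m<n , s = m , m<n⇒m<1+n m<n , s

  site-run : ∀ {n} → Site n → 3 ≤ run (suc n)
  site-run {n} (_ , _ , h) = ≤-trans (s≤s (s≤s (lastSite-positive n))) h

  site-end : ∀ {n} → Site n → d (suc n) ≢ d (suc (suc n))
  site-end = proj₁

  site-same : ∀ {n} → Site n → d n ≡ d (suc n)
  site-same s = proj₁ (run-grows (≤-trans (n≤1+n 2) (site-run s)))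

  site-run′ : ∀ {n} → Site n → 2 ≤ run n
  site-run′ s with run-grows (≤-trans (n≤1+n 2) (site-run s))
  ... | _ , e = ≤-pred (subst (3 ≤_) e (site-run s))

  site-same′ : ∀ {k} → Site (suc k) → d k ≡ d (suc k)
  site-same′ s = proj₁ (run-grows (site-run′ s))

  -- The last three arcs of a chosen phase agree, so another site this close would put the end of
  -- one phase inside the other.
  site-gap₁ : ∀ {n} → Site n → ¬ Site (suc n)
  site-gap₁ s s′ = site-end s (site-same s′)

  site-gap₂ : ∀ {n} → Site n → ¬ Site (suc (suc n))
  site-gap₂ s s′ = site-end s (site-same′ s′)

  -- If no site is left, a phase that beats all earlier ones exceeds `lastSite N` by at most one, so
  -- the maximum of the finished phases stays bounded.
  completed-bounded : ∀ N → (∀ n → N ≤ n → ¬ Site n) →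
    ∀ k → completed (suc N + k) ≤ completed (suc N) ⊔ suc (lastSite N)
          × lastSite (N + k) ≡ lastSite N
  completed-bounded N none zero rewrite +-identityʳ N = m≤m⊔n _ _ , refl
  completed-bounded N none (suc k) rewrite +-suc N k =
    step , trans (lastSite-nonsite (none (N + k) (m≤m+n N k))) (proj₂ ih)
    where
    K : ℕ
    K = completed (suc N) ⊔ suc (lastSite N)
    ih : completed (suc N + k) ≤ K × lastSite (N + k) ≡ lastSite N
    ih = completed-bounded N none k
    run≤ : d (suc (suc (N + k))) ≢ d (suc (N + k)) → run (suc (N + k)) ≤ K
    run≤ e with completed (suc (N + k)) <? run (suc (N + k))
    ... | no h = ≤-trans (≮⇒≥ h) (proj₁ ih)
    ... | yes h with suc (suc (lastSite (N + k))) ≤? run (suc (N + k))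
    ... | yes h′ = ⊥-elim (none (N + k) (m≤m+n N k) (e ∘ sym , h , h′))
    ... | no h′ = m≤n⇒m≤o⊔n _ (subst (λ z → run (suc (N + k)) ≤ suc z) (proj₂ ih) (≤-pred (≰⇒> h′)))
    step : completed (suc (suc (N + k))) ≤ K
    step with d (suc (suc (N + k))) Bool.≟ d (suc (N + k))
    ... | yes _ = proj₁ ih
    ... | no e = ⊔-lub (proj₁ ih) (run≤ e)

  completed-mono : ∀ {m n} → m ≤ n → completed m ≤ completed n
  completed-mono = suc-monotone completed completed-suc

  phase-completed : ∀ {a l} → IsPhase d a l → l ≤ completed (a + l)
  phase-completed {a} {suc l} (_ , const , _ , end) rewrite +-suc a l =
    subst (suc l ≤_) (sym (completed-diff λ e → end (trans e (const l ≤-refl))))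
      (m≤n⇒m≤o⊔n _ (long l ≤-refl))
    where
    long : ∀ i → i < suc l → i < run (a + i)
    long zero _ = run-positive (a + zero)
    long (suc i) h = subst (suc i <_) (sym eq) (s≤s (long i (<-trans ≤-refl h)))
      where
      eq : run (a + suc i) ≡ suc (run (a + i))
      eq = trans (cong run (+-suc a i)) (run-same (trans (cong d (sym (+-suc a i)))
             (trans (const (suc i) h) (sym (const i (<-trans ≤-refl h))))))

  module _ (unbounded : RepresentingSequenceUnbounded d) where

    site-beyond : ∀ N → ¬ ¬ (∃ λ n → N ≤ n × Site n)
    site-beyond N k = unbounded (completed (suc N) ⊔ suc (lastSite N)) λ a l ph →
      ≤-trans (phase-completed ph) (≤-trans (completed-mono (m≤n+m (a + l) (suc N)))
        (proj₁ (completed-bounded N (λ n N≤n s → k (n , N≤n , s)) (a + l))))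

    -- Suppose there is none. Then `count` stays constant from `N` on by induction, so any site
    -- beyond `N` already has the required count.
    next-site : ∀ N → ¬ ¬ (∃ λ n → Site n × count n ≡ count N)
    next-site N k = site-beyond N λ { (n , N≤n , s) → search n N≤n s }
      where
      none : ∀ j → (count (N + j) ≡ count N)
      none zero = cong count (+-identityʳ N)
      none (suc j) = trans (cong count (+-suc N j))
        (trans (count-nonsite λ s → k (N + j , s , none j)) (none j))
      search : ∀ n → N ≤ n → Site n → ⊥
      search n N≤n s with m≤n⇒∃[o]m+o≡n N≤n
      ... | j , refl = k (N + j , s , none j)

    nth-site : ∀ s → ¬ ¬ (∃ λ n → Site n × count n ≡ s)
    nth-site zero k = next-site 0 k
    nth-site (suc s) k = nth-site s λ { (n , h , eq) →
      next-site (suc n) λ { (m , h′ , eq′) →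
        k (m , h′ , trans eq′ (trans (count-site h) (cong suc eq))) } }

  -- The host digraph and its rays.

  -- Vertex n of ray u is vertex suc n of ray t.
  Merge : ℕ → Index → Index → Set
  Merge n u t = Site n × indexPair (count n) ≡ (u , t) × Clash u t

  -- Abstract so that the case distinction in ray stays folded.
  abstract
    merge? : ∀ n u t → Dec (Merge n u t)
    merge? n u t = site? n ×-dec (≡-dec (≡-dec _≟_ _≟_) (≡-dec _≟_ _≟_) _ _ ×-dec clash? u t)

  Vertex : Set
  Vertex = Index × ℕ

  -- Rays are glued by a choice of names instead of a quotient: a shared vertex is named after the
  -- ray on which its number is smaller.
  ray : Index → ℕ → Vertex
  ray t zero = t , zero
  ray t (suc n) = if does (merge? n u t) then (u , n) else (t , suc n)
    where
    u : Index
    u = proj₁ (indexPair (count n))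

  data View (t : Index) : ℕ → Vertex → Set where
    plain  : ∀ {n} → View t n (t , n)
    merged : ∀ {n u} → Merge n u t → View t (suc n) (u , n)

  view : ∀ t n → View t n (ray t n)
  view t zero = plain
  view t (suc n) with merge? n (proj₁ (indexPair (count n))) t
  ... | yes m = merged m
  ... | no _ = plain

  data Meet : Index → ℕ → Index → ℕ → Set where
    same  : ∀ {t n} → Meet t n t n
    below : ∀ {u t n} → Merge n u t → Meet u n t (suc n)
    above : ∀ {u t n} → Merge n u t → Meet t (suc n) u n

  views-meet : ∀ {t x t′ y v} → View t x v → View t′ y v → Meet t x t′ y
  views-meet plain plain = same
  views-meet plain (merged m) = below m
  views-meet (merged m) plain = above m
  -- The site `n` determines both indices, so at most two rays pass through a vertex.
  views-meet (merged (_ , e , _)) (merged (_ , e′ , _)) with trans (sym e) e′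
  ... | refl = same

  meet : ∀ {t x t′ y} → ray t x ≡ ray t′ y → Meet t x t′ y
  meet {t} {x} {t′} {y} eq = views-meet (view t x) (subst (View t′ y) (sym eq) (view t′ y))

  merge-site : ∀ {n u t} → Merge n u t → Site n
  merge-site = proj₁

  ray-merged : ∀ {n u t} → Merge n u t → ray t (suc n) ≡ (u , n)
  ray-merged {n} {u} {t} m rewrite cong proj₁ (proj₁ (proj₂ m)) | dec-true (merge? n u t) m = refl

  ray-lower : ∀ {n u t} → Merge n u t → ray u n ≡ (u , n)
  ray-lower {zero} m = refl
  ray-lower {suc n} {u} m with merge? n (proj₁ (indexPair (count n))) u
  ... | yes m′ = ⊥-elim (site-gap₁ (merge-site m′) (merge-site m))
  ... | no _ = refl

  merge-chain : ∀ {n u t w} → Merge n u t → ¬ Merge n t w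
  merge-chain (_ , e , u≢t , _) (_ , e′ , _) = u≢t (cong proj₁ (trans (sym e) e′))

  Host : Digraph
  Host = record
    { V = Vertex
    ; E = λ x y → ∃ λ t → ∃₂ λ m n → RayArc d m n × x ≡ ray t m × y ≡ ray t n }

  rayCopy : Index → Copy (OrientedRay d) Host
  rayCopy t = record
    { map = ray t
    ; inj = λ x y eq → injective (meet {t} {x} {t} {y} eq)
    ; hom = λ x y a → t , x , y , a , refl , refl }
    where
    injective : ∀ {x y} → Meet t x t y → x ≡ y
    injective same = refl
    injective (below (_ , _ , t≢t , _)) = ⊥-elim (t≢t refl)
    injective (above (_ , _ , t≢t , _)) = ⊥-elim (t≢t refl)

  manyCopies : ∀ k → HasDisjointCopies k (OrientedRay d) Host
  manyCopies k = (λ i → rayCopy (k , toℕ i)) ,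
    λ i j i≢j x y eq → disjoint {x = x} {y} (i≢j ∘ toℕ-injective) (toℕ<n i) (toℕ<n j) (meet eq)
    where
    disjoint : ∀ {i j x y} → i ≢ j → i < k → j < k → ¬ Meet (k , i) x (k , j) y
    disjoint i≢j i<k j<k same = i≢j refl
    disjoint i≢j i<k j<k (below (_ , _ , _ , h)) = h (refl , i<k , j<k)
    disjoint i≢j i<k j<k (above (_ , _ , _ , h)) = h (refl , j<k , i<k)

  -- The number x ∸ count x depends on the vertex only, not on the ray used to reach it.
  meet-count : ∀ {t x t′ y} → Meet t x t′ y → y + count x ≡ x + count y
  meet-count same = refl
  meet-count (below {n = n} m) = sym (trans (cong (n +_) (count-site (merge-site m))) (+-suc n _))
  meet-count (above {n = n} m) = trans (cong (n +_) (count-site (merge-site m))) (+-suc n _)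

  -- Arc n of ray t is one of the two arcs of its phase after a shared vertex
  -- that has the smaller number on t.
  Past : Index → ℕ → Set
  Past t n = (∃ λ w → Merge n t w) ⊎ (∃₂ λ w m → n ≡ suc m × Merge m t w)

  past-site : ∀ {t n} → Past t n → ∃ λ m → m ≤ n × Site m × run n ≤ run (suc m)
  past-site {n = n} (inj₁ (_ , m)) = n , ≤-refl , merge-site m ,
    ≤-trans (n≤1+n _) (≤-reflexive (sym (run-same (sym (site-same (merge-site m))))))
  past-site (inj₂ (_ , k , refl , m)) = k , n≤1+n k , merge-site m , ≤-refl

  -- How a copy can run through the host.

  module Follow (P : Copy (OrientedRay d) Host) where

    p : ℕ → Vertex
    p = map P

    -- Travelling towards the start of `t` swaps in- and out-oriented, hence the inequality in
    -- `Down`.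
    Up Down : Index → ℕ → ℕ → Set
    Up t n i = p i ≡ ray t n × p (suc i) ≡ ray t (suc n) × d n ≡ d i
    Down t n i = p i ≡ ray t (suc n) × p (suc i) ≡ ray t n × d n ≢ d i

    step : ∀ i → (∃₂ λ t n → Up t n i) ⊎ (∃₂ λ t n → Down t n i)
    step i with d i in eq
    ... | true with hom P i (suc i) (inj₁ (refl , eq))
    ...   | t , m , n , inj₁ (refl , e) , e₁ , e₂ = inj₁ (t , m , e₁ , e₂ , e)
    ...   | t , m , n , inj₂ (refl , e) , e₁ , e₂ =
              inj₂ (t , n , e₁ , e₂ , λ e′ → contradiction (trans (sym e) e′) λ ())
    step i | false with hom P (suc i) i (inj₂ (refl , eq))
    ...   | t , m , n , inj₁ (refl , e) , e₁ , e₂ =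
              inj₂ (t , m , e₂ , e₁ , λ e′ → contradiction (trans (sym e) e′) λ ())
    ...   | t , m , n , inj₂ (refl , e) , e₁ , e₂ = inj₁ (t , n , e₂ , e₁ , e)

    no-return : ∀ {i v} → p i ≡ v → p (suc (suc i)) ≢ v
    no-return {i} e e′ = m+1+n≢m i {1} (trans (+-comm i 2) (inj P _ _ (trans e′ (sym e))))

    -- Turning back would need a change of orientation. Even a shared vertex offers none, as it lies
    -- inside the phase on both rays.
    up-up : ∀ {t n i} → Up t n i → d (suc i) ≡ d i →
      ∃₂ λ t′ n′ → Up t′ n′ (suc i) × Meet t (suc n) t′ n′
    up-up {i = i} (e₁ , e₂ , e₃) c with step (suc i)
    ... | inj₁ (t′ , n′ , u@(f₁ , _)) = t′ , n′ , u , meet (trans (sym e₂) f₁)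
    ... | inj₂ (t′ , n′ , f₁ , f₂ , f₃) = ⊥-elim (go e₃ (meet (trans (sym e₂) f₁)) f₃)
      where
      go : ∀ {t n t′ n′} → d n ≡ d i → Meet t (suc n) t′ (suc n′) → d n′ ≢ d (suc i) → ⊥
      go e₃ same f₃ = f₃ (trans e₃ (sym c))
      go e₃ (below m) f₃ = f₃ (trans (sym (site-same′ (merge-site m))) (trans e₃ (sym c)))
      go e₃ (above m) f₃ = f₃ (trans (site-same′ (merge-site m)) (trans e₃ (sym c)))

    down-down : ∀ {t n i} → Down t n i → d (suc i) ≡ d i →
      ∃₂ λ t′ n′ → Down t′ n′ (suc i) × Meet t n t′ (suc n′)
    down-down {i = i} (e₁ , e₂ , e₃) c with step (suc i)
    ... | inj₂ (t′ , n′ , u@(f₁ , _)) = t′ , n′ , u , meet (trans (sym e₂) f₁)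
    ... | inj₁ (t′ , n′ , f₁ , f₂ , f₃) = ⊥-elim (go e₃ (meet (trans (sym e₂) f₁)) f₃)
      where
      go : ∀ {t n t′ n′} → d n ≢ d i → Meet t n t′ n′ → d n′ ≡ d (suc i) → ⊥
      go e₃ same f₃ = e₃ (trans f₃ c)
      go e₃ (below m) f₃ = e₃ (trans (site-same (merge-site m)) (trans f₃ c))
      go e₃ (above m) f₃ = e₃ (trans (sym (site-same (merge-site m))) (trans f₃ c))

    Steady : ℕ → ℕ → Set
    Steady k a = ∀ i → i < k → d (suc (i + a)) ≡ d (i + a)

    -- A path that stays within a phase can lose a step against the numbering only
    -- once, at the shared vertex of that phase, when it switches to the ray on which
    -- this vertex has the smaller number.
    up-run : ∀ k {t n a} → Steady k a → Up t n a →
      ∃₂ λ t′ n′ → Up t′ n′ (k + a) × n′ + run n ≡ n + run n′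
        × (k + run n ≤ run n′ ⊎ (k + run n ≤ suc (run n′) × Past t′ n′))
    up-run zero _ u = _ , _ , u , refl , inj₁ ≤-refl
    up-run (suc k) {n = n₀} {a} steady u
      with up-run k (λ i i<k → steady i (m<n⇒m<1+n i<k)) u
    ... | t , n , u′ , eq , bound with up-up u′ (steady k ≤-refl)
    ... | t′ , n′ , u″ , m = t′ , n′ , u″ , go m dir eq bound
      where
      dir : d n′ ≡ d n
      dir = trans (proj₂ (proj₂ u″)) (trans (steady k ≤-refl) (sym (proj₂ (proj₂ u′))))
      shift : ∀ {n} → d (suc n) ≡ d n → n + run n₀ ≡ n₀ + run n →
        suc n + run n₀ ≡ n₀ + run (suc n)
      shift {n} e eq = trans (cong suc eq) (trans (sym (+-suc n₀ _)) (cong (n₀ +_) (sym (run-same e))))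
      go : ∀ {t n t′ n′} → Meet t (suc n) t′ n′ → d n′ ≡ d n → n + run n₀ ≡ n₀ + run n →
        (k + run n₀ ≤ run n ⊎ (k + run n₀ ≤ suc (run n) × Past t n)) →
        n′ + run n₀ ≡ n₀ + run n′
          × (suc k + run n₀ ≤ run n′ ⊎ (suc k + run n₀ ≤ suc (run n′) × Past t′ n′))
      go same e eq (inj₁ h) = shift e eq , inj₁ (subst (_ ≤_) (sym (run-same e)) (s≤s h))
      go same e eq (inj₂ (h , inj₁ (w , m))) =
        shift e eq , inj₂ (s≤s (subst (_ ≤_) (sym (run-same e)) h) , inj₂ (w , _ , refl , m))
      go same e eq (inj₂ (h , inj₂ (w , _ , refl , m))) = ⊥-elim (site-end (merge-site m) (sym e))
      go {n = n} (below m) e eq h = shift e₂ (shift e₁ eq) , inj₁ (≤-trans (s≤s (weak h)) (≤-reflexive (sym r)))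
        where
        e₁ : d (suc n) ≡ d n
        e₁ = sym (site-same′ (merge-site m))
        e₂ : d (suc (suc n)) ≡ d (suc n)
        e₂ = sym (site-same (merge-site m))
        r : run (suc (suc n)) ≡ suc (suc (run n))
        r = trans (run-same e₂) (cong suc (run-same e₁))
        weak : ∀ {A x y} → x ≤ y ⊎ (x ≤ suc y × A) → x ≤ suc y
        weak (inj₁ h) = m≤n⇒m≤1+n h
        weak (inj₂ (h , _)) = h
      go (above m) e eq (inj₁ h) = eq , inj₂ (s≤s h , inj₁ (_ , m))
      go (above m) e eq (inj₂ (h , inj₁ (_ , m′))) = ⊥-elim (merge-chain m m′)
      go (above m) e eq (inj₂ (h , inj₂ (_ , _ , refl , m′))) =
        ⊥-elim (site-gap₁ (merge-site m′) (merge-site m))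

    -- Each step down uses up one of the `run n` arcs. A switch at the shared vertex to the ray
    -- where its number is larger gains one arc, since the arc of the same number is then used on
    -- both rays.
    down-run : ∀ k {t n a} → Steady k a → Down t n a →
      k < run n ⊎ (k ≤ run n × Past t n)
    down-run zero {n = n} _ _ = inj₁ (run-positive n)
    down-run (suc k) {n = n} {a} steady u with down-down u (steady 0 (s≤s z≤n))
    ... | t′ , n′ , u′ , m = go m dir (down-run k steady′ u′)
      where
      steady′ : Steady k (suc a)
      steady′ i i<k rewrite +-suc i a = steady (suc i) (s≤s i<k)
      dir : d n′ ≡ d n
      dir = trans (Bool.¬-not (λ e → proj₂ (proj₂ u′) (trans e (sym (steady 0 (s≤s z≤n))))))
        (sym (Bool.¬-not (proj₂ (proj₂ u))))
      go : ∀ {t n t′ n′} → Meet t n t′ (suc n′) → d n′ ≡ d n →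
        k < run n′ ⊎ (k ≤ run n′ × Past t′ n′) → suc k < run n ⊎ (suc k ≤ run n × Past t n)
      go same e (inj₁ h) = inj₁ (subst (_ <_) (sym (run-same (sym e))) (s≤s h))
      go same e (inj₂ (h , inj₁ (w , m))) =
        inj₂ (subst (_ ≤_) (sym (run-same (sym e))) (s≤s h) , inj₂ (w , _ , refl , m))
      go same e (inj₂ (h , inj₂ (w , _ , refl , m))) = ⊥-elim (site-end (merge-site m) e)
      go (below m) e (inj₁ h) = inj₂ (h , inj₁ (_ , m))
      go (below m) e (inj₂ (h , inj₁ (_ , m′))) = ⊥-elim (merge-chain m m′)
      go (below m) e (inj₂ (h , inj₂ (_ , _ , refl , m′))) =
        ⊥-elim (site-gap₁ (merge-site m′) (merge-site m))
      go {n′ = n′} (above m) e h = inj₁ (subst (suc k <_) (sym r) (s≤s (s≤s (weak h))))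
        where
        r : run (suc (suc n′)) ≡ suc (suc (run n′))
        r = trans (run-same (sym (site-same (merge-site m))))
          (cong suc (run-same (sym (site-same′ (merge-site m)))))
        weak : ∀ {A x y} → x < y ⊎ (x ≤ y × A) → x ≤ y
        weak (inj₁ h) = <⇒≤ h
        weak (inj₂ (h , _)) = h

    -- One number ahead, the copy meets the end of the ray's phase with an arc of its own phase to
    -- go, and no arc there can take it.
    overshoot : ∀ {t t′ i} → Merge (suc i) t t′ → p (2 + i) ≢ ray t′ (3 + i)
    overshoot {t} {t′} {i} m e with step (2 + i)
    ... | inj₁ (_ , _ , g₁ , _ , g₃) = go (meet (trans (sym e) g₁)) g₃
      where
      go : ∀ {t″ n} → Meet t′ (3 + i) t″ n → d n ≢ d (2 + i)
      go same g = site-end (merge-site m) (sym g)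
      go (below m′) _ = site-gap₂ (merge-site m) (merge-site m′)
      go (above m′) _ = site-gap₁ (merge-site m) (merge-site m′)
    ... | inj₂ (_ , _ , g₁ , _ , g₃) = go m (meet (trans (sym e) g₁)) g₃
      where
      go : ∀ {t t′ i t″ n} → Merge (suc i) t t′ → Meet t′ (3 + i) t″ (suc n) → ¬ (d n ≢ d (2 + i))
      go m same g = g refl
      go m (below m′) _ = site-gap₂ (merge-site m) (merge-site m′)
      go m (above m′) _ = site-gap₁ (merge-site m) (merge-site m′)

    -- One number behind, the copy has finished its phase while the ray has arc `suc i` of it left.
    -- The arc back has a suitable orientation but leads to a vertex already visited.
    lag : ∀ {u t i} → Merge i u t → p (suc i) ≡ ray u i → p (2 + i) ≢ ray u (suc i)
    lag {u} {t} {i} m e₁ e₂ with step (2 + i)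
    ... | inj₁ (_ , _ , g₁ , _ , g₃) = go (meet (trans (sym e₂) g₁)) g₃
      where
      go : ∀ {t″ n} → Meet u (suc i) t″ n → d n ≢ d (2 + i)
      go same g = site-end (merge-site m) g
      go (below m′) _ = site-gap₁ (merge-site m) (merge-site m′)
      go (above m′) _ = merge-chain m′ m
    ... | inj₂ (_ , _ , g₁ , g₂ , _) = go m e₁ (meet (trans (sym e₂) g₁)) g₂
      where
      go : ∀ {u t i t″ n} → Merge i u t → p (suc i) ≡ ray u i → Meet u (suc i) t″ (suc n) →
        p (3 + i) ≢ ray t″ n
      go m e same g = no-return e g
      go m e (below m′) _ = site-gap₁ (merge-site m) (merge-site m′)
      go m e (above m′) _ = merge-chain m′ m

    -- Switching rays would put the copy one ahead or one behind, against `overshoot` and `lag`;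
    -- turning back fails by `no-return` or by orientation.
    follow : ∀ {t i} → Up t i i → Up t (suc i) (suc i)
    follow {t} {i} (e₁ , e₂ , _) with step (suc i)
    ... | inj₁ (_ , _ , f₁ , f₂ , f₃) = go (meet (trans (sym e₂) f₁)) f₁ f₂ f₃
      where
      go : ∀ {t′ n} → Meet t (suc i) t′ n → p (suc i) ≡ ray t′ n → p (2 + i) ≡ ray t′ (suc n) →
        d n ≡ d (suc i) → Up t (suc i) (suc i)
      go same f₁ f₂ f₃ = f₁ , f₂ , f₃
      go (below m) f₁ f₂ _ = ⊥-elim (overshoot m f₂)
      go (above m) f₁ f₂ _ = ⊥-elim (lag m f₁ f₂)
    ... | inj₂ (_ , _ , f₁ , f₂ , f₃) = ⊥-elim (go e₁ (meet (trans (sym e₂) f₁)) f₂ f₃)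
      where
      go : ∀ {t i t′ n} → p i ≡ ray t i → Meet t (suc i) t′ (suc n) → p (2 + i) ≡ ray t′ n →
        ¬ (d n ≢ d (suc i))
      go e same f _ = no-return e f
      go e (below m) _ g = g refl
      go e (above m) _ g = g (trans (site-same′ (merge-site m)) (site-same (merge-site m)))

    follow-forever : ∀ {t a} → Up t a a → ∀ i → p (i + a) ≡ ray t (i + a)
    follow-forever {t} {a} u i = proj₁ (go i)
      where
      go : ∀ i → Up t (i + a) (i + a)
      go zero = u
      go (suc i) = follow (go i)

    -- Arc `b` of the copy has the other orientation, yet would arrive inside the phase, where it
    -- fits only on the arc by which the copy leaves again. No shared vertex is this close to the
    -- start of the phase.
    not-shifted : ∀ {t b} → d b ≢ d (suc b) → d (suc b) ≡ d (2 + b) → d (3 + b) ≡ d (4 + b) →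
      ¬ Up t (2 + b) (suc b)
    not-shifted {t} {b} turn same₁ same₂ (e₁ , e₂ , _) with step b
    ... | inj₁ (_ , _ , _ , g₂ , g₃) = go turn same₁ (meet (trans (sym e₁) g₂)) g₃
      where
      go : ∀ {t b t′ n} → d b ≢ d (suc b) → d (suc b) ≡ d (2 + b) → Meet t (2 + b) t′ (suc n) →
        d n ≢ d b
      go turn same₁ same g = turn (sym g)
      go turn same₁ (below m) g = turn (sym (trans same₁ g))
      go turn same₁ (above m) _ = turn (site-same′ (merge-site m))
    ... | inj₂ (_ , _ , g₁ , g₂ , _) = go (meet (trans (sym e₁) g₂)) g₁
      where
      go : ∀ {t′ n} → Meet t (2 + b) t′ n → p b ≢ ray t′ (suc n)
      go same g = no-return g e₂
      go (below m) _ = site-end (merge-site m) same₂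
      go (above m) _ = turn (site-same′ (merge-site m))

    -- Bounding the lead of a copy over its own numbering.

    level-meet : ∀ {t x t′ y} B → Meet t x t′ y → x ≤ B + count x → y ≤ B + count y
    level-meet {x = x} {y = y} B m h = +-cancelʳ-≤ (count x) _ _ (begin
      y + count x              ≡⟨ meet-count m ⟩
      x + count y              ≤⟨ +-monoˡ-≤ (count y) h ⟩
      B + count x + count y    ≡⟨ +-assoc B _ _ ⟩
      B + (count x + count y)  ≡⟨ cong (B +_) (+-comm (count x) _) ⟩
      B + (count y + count x)  ≡⟨ +-assoc B _ _ ⟨
      B + count y + count x    ∎)
      where open ≤-Reasoning

    -- `x ∸ count x` is unchanged by a switch of rays and grows by at most one per arc; sums replace
    -- the truncated subtraction.
    level : ∀ {t₀ x₀} → p 0 ≡ ray t₀ x₀ → ∀ i {t x} → p i ≡ ray t x → x ≤ x₀ + i + count x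
    level {x₀ = x₀} e₀ zero e = level-meet (x₀ + 0) (meet (trans (sym e₀) e))
      (≤-trans (m≤m+n x₀ 0) (m≤m+n _ _))
    level {x₀ = x₀} e₀ (suc i) e rewrite +-suc x₀ i with step i
    ... | inj₁ (_ , n , e₁ , e₂ , _) = level-meet (suc (x₀ + i)) (meet (trans (sym e₂) e))
      (s≤s (≤-trans (level e₀ i e₁) (+-monoʳ-≤ (x₀ + i) (count-≤-suc n))))
    ... | inj₂ (_ , n , e₁ , e₂ , _) = level-meet (suc (x₀ + i)) (meet (trans (sym e₂) e))
      (m≤n⇒m≤1+n (≤-pred (begin
        suc n                        ≤⟨ level e₀ i e₁ ⟩
        x₀ + i + count (suc n)       ≤⟨ +-monoʳ-≤ (x₀ + i) (count-suc-≤ n) ⟩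
        x₀ + i + suc (count n)       ≡⟨ +-suc (x₀ + i) _ ⟩
        suc (x₀ + i + count n)       ∎)))
      where open ≤-Reasoning

    -- A copy at the start of a late chosen phase.

    module AtSite {σ} (s : Site σ) {t₀ x₀} (e₀ : p 0 ≡ ray t₀ x₀) (x₀<c : x₀ < count σ) where

      open Phase (phase (suc σ))

      k : ℕ
      k = pred (run (suc σ))

      suc-k : suc k ≡ run (suc σ)
      suc-k = suc-pred (run (suc σ)) {{>-nonZero (run-positive (suc σ))}}

      k+first : k + first ≡ suc σ
      k+first = cong pred
        (trans (+-comm (suc k) first) (trans (cong (first +_) suc-k) length≡))

      long : suc (suc (count σ + count σ)) ≤ k
      long = ≤-pred (subst (3 + (count σ + count σ) ≤_) (sym suc-k)
        (≤-trans (s≤s (s≤s (count-lastSite σ))) (proj₂ (proj₂ s))))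

      4≤k : 4 ≤ k
      4≤k = ≤-trans (s≤s (s≤s (+-mono-≤ c≥1 c≥1))) long
        where
        c≥1 : 1 ≤ count σ
        c≥1 = ≤-trans (s≤s z≤n) x₀<c

      within : ∀ {i} → i ≤ k → d (i + first) ≡ d (suc σ)
      within {i} i≤k = dir (m≤n+m first i) (≤-trans (+-monoˡ-≤ first i≤k) (≤-reflexive k+first))

      steady : Steady k first
      steady i i<k = trans (within i<k) (sym (within (<⇒≤ i<k)))

      -- Reaching number `suc σ` means being `k` ahead. By `level` and `count-antitone` this needs
      -- `k ≤ x₀ + count (suc σ)`, but `long` and `x₀<c` make `k` larger.
      near : ∀ {t x} → p first ≡ ray t x → x < suc σ
      near {t} {x} e = ≰⇒> λ f≤x → <⇒≱ x₀<c (≤-trans (n≤1+n _) (+-cancelʳ-≤ (suc c) _ _ (begin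
        suc c + suc c            ≡⟨ cong suc (+-suc c c) ⟩
        suc (suc (c + c))        ≤⟨ long ⟩
        k                        ≤⟨ k≤ f≤x ⟩
        x₀ + count (suc σ)       ≡⟨ cong (x₀ +_) (count-site s) ⟩
        x₀ + suc c               ∎)))
        where
        open ≤-Reasoning
        c : ℕ
        c = count σ
        k≤ : suc σ ≤ x → k ≤ x₀ + count (suc σ)
        k≤ f≤x = +-cancelʳ-≤ (first + count x) _ _ (begin
          k + (first + count x)                        ≡⟨ +-assoc k _ _ ⟨
          k + first + count x                          ≡⟨ cong (_+ count x) k+first ⟩
          suc σ + count x                              ≤⟨ count-antitone f≤x ⟩
          x + count (suc σ)                            ≤⟨ +-monoˡ-≤ (count (suc σ)) (level {t₀} {x₀} e₀ first {t} {x} e) ⟩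
          x₀ + first + count x + count (suc σ)         ≡⟨ cong (_+ count (suc σ)) (+-assoc x₀ _ _) ⟩
          x₀ + (first + count x) + count (suc σ)       ≡⟨ +-assoc x₀ _ _ ⟩
          x₀ + ((first + count x) + count (suc σ))     ≡⟨ cong (x₀ +_) (+-comm (first + count x) _) ⟩
          x₀ + (count (suc σ) + (first + count x))     ≡⟨ +-assoc x₀ _ _ ⟨
          x₀ + count (suc σ) + (first + count x)       ∎)

      first<σ : first < σ
      first<σ = ≤-pred (begin
        2 + first   ≤⟨ +-monoˡ-≤ first (≤-trans (s≤s (s≤s z≤n)) 4≤k) ⟩
        k + first   ≡⟨ k+first ⟩
        suc σ       ∎)
        where open ≤-Reasoning

      -- The phase of a site beats every earlier phase, and the earlier chosen ones even by two. The
      -- second margin makes up for the one arc that a switch can gain there.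
      not-earlier : ∀ {t j} → k < run j ⊎ (k ≤ run j × Past t j) → first ≤ j
      not-earlier {t} {j} h = ≮⇒≥ λ j<a → go j<a h
        where
        go : j < first → ¬ (k < run j ⊎ (k ≤ run j × Past t j))
        go j<a (inj₁ h) = <⇒≱ (proj₁ (proj₂ s))
          (≤-trans (≤-trans (≤-reflexive (sym suc-k)) h) (earlier j<a))
        go j<a (inj₂ (h , q)) with past-site q
        ... | m , m≤j , sm , r = <⇒≱ (proj₂ (proj₂ s)) (begin
          run (suc σ)             ≡⟨ suc-k ⟨
          suc k                   ≤⟨ s≤s (≤-trans h r) ⟩
          suc (run (suc m))       ≡⟨ cong suc (lastSite-site sm) ⟨
          suc (lastSite (suc m))  ≤⟨ s≤s (lastSite-mono m<σ) ⟩
          suc (lastSite σ)        ∎)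
          where
          open ≤-Reasoning
          m<σ : m < σ
          m<σ = ≤-<-trans m≤j (<-trans j<a first<σ)

      -- `down-run` and `near` place arc `n` in this very phase, where its orientation contradicts
      -- `Down`.
      not-down : ∀ {t n} → ¬ Down t n first
      not-down {t} {n} u@(e₁ , _ , e₃) =
        e₃ (trans (dir a≤n (≤-trans (n≤1+n n) (<⇒≤ (near e₁)))) (sym (within z≤n)))
        where
        a≤n : first ≤ n
        a≤n = not-earlier (down-run k steady u)

      -- The `k` further arcs have to fit into the same phase, which has `suc k` arcs; the one step
      -- that a switch may lose leaves room for `n` to be one too large.
      up-first : ∀ {t n} → Up t n first → n ≡ first ⊎ n ≡ suc first
      up-first {t} {n} u with up-run k steady u
      ... | t′ , n′ , _ , eq , bound = result
        where
        open ≤-Reasoning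
        weaken : k + run n ≤ run n′ ⊎ (k + run n ≤ suc (run n′) × Past t′ n′) →
          k < run n′ ⊎ (k ≤ run n′ × Past t′ n′)
        weaken (inj₁ h) = inj₁ (≤-trans (≤-reflexive (+-comm 1 k))
          (≤-trans (+-monoʳ-≤ k (run-positive n)) h))
        weaken (inj₂ (h , q)) = inj₂ (≤-pred (≤-trans (≤-reflexive (+-comm 1 k))
          (≤-trans (+-monoʳ-≤ k (run-positive n)) h)) , q)
        weak : k + run n ≤ run n′ ⊎ (k + run n ≤ suc (run n′) × Past t′ n′) →
          k + run n ≤ suc (run n′)
        weak (inj₁ h) = m≤n⇒m≤1+n h
        weak (inj₂ (h , _)) = h
        run-first : run first ≡ 1
        run-first = +-cancelˡ-≡ first _ _ (trans (run≡ ≤-refl first≤) (+-comm 1 first))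
        a≤n : first ≤ n
        a≤n = +-cancelʳ-≤ (run n′) _ _ (begin
          first + run n′   ≤⟨ run-antitone (not-earlier (weaken bound)) ⟩
          n′ + run first   ≡⟨ cong (n′ +_) run-first ⟩
          n′ + 1           ≤⟨ +-monoʳ-≤ n′ (run-positive n) ⟩
          n′ + run n       ≡⟨ eq ⟩
          n + run n′       ∎)
        run-n : first + run n ≡ suc n
        run-n = run≡ a≤n (<⇒≤ (near (proj₁ u)))
        run-n′ : first + run n′ ≡ suc n′
        run-n′ = +-cancelʳ-≡ (run n) _ _ (begin-equality
          first + run n′ + run n    ≡⟨ +-assoc first _ _ ⟩
          first + (run n′ + run n)  ≡⟨ cong (first +_) (+-comm (run n′) _) ⟩
          first + (run n + run n′)  ≡⟨ +-assoc first _ _ ⟨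
          first + run n + run n′    ≡⟨ cong (_+ run n′) run-n ⟩
          suc (n + run n′)          ≡⟨ cong suc eq ⟨
          suc n′ + run n            ∎)
        -- Beyond `suc σ` a new phase has begun, so `run n′` could not count from `first`.
        n′≤ : n′ ≤ suc σ
        n′≤ = ≮⇒≥ λ f<n′ → <⇒≱ (≤-trans first<σ (m≤n+m σ 2)) (+-cancelʳ-≤ (run n′) _ _ (begin
          2 + σ + run n′       ≤⟨ run-antitone f<n′ ⟩
          n′ + run (2 + σ)     ≡⟨ cong (n′ +_) (run-diff (site-end s ∘ sym)) ⟩
          n′ + 1               ≡⟨ +-comm n′ 1 ⟩
          suc n′               ≡⟨ run-n′ ⟨
          first + run n′       ∎))
        run≤2 : run n ≤ 2
        run≤2 = +-cancelˡ-≤ k _ _ (begin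
          k + run n       ≤⟨ weak bound ⟩
          suc (run n′)    ≤⟨ s≤s (+-cancelˡ-≤ first _ _
                               (subst₂ _≤_ (sym run-n′) (sym length≡) (s≤s n′≤))) ⟩
          suc (run (suc σ)) ≡⟨ cong suc suc-k ⟨
          2 + k           ≡⟨ +-comm 2 k ⟩
          k + 2           ∎)
        result : n ≡ first ⊎ n ≡ suc first
        result with run n | run-positive n | run≤2 | run-n
        ... | 1 | _ | _ | e = inj₁ (cong pred (trans (sym e) (+-comm first 1)))
        ... | 2 | _ | _ | e = inj₂ (cong pred (trans (sym e) (+-comm first 2)))
        ... | suc (suc (suc _)) | _ | s≤s (s≤s ()) | _

      -- There is an earlier site as `count σ` is positive, and its phase has ended. `not-shifted`
      -- needs the arc before `first`.
      first-positive : ∃ λ b → first ≡ suc b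
      first-positive with first in eq | count-positive σ (≤-trans (s≤s z≤n) x₀<c)
      ... | suc b | _ = b , refl
      ... | zero | m , m<σ , sm = ⊥-elim (site-end sm
        (trans (dir (subst (_≤ _) (sym eq) z≤n) (s≤s (<⇒≤ m<σ)))
          (sym (dir (subst (_≤ _) (sym eq) z≤n) (s≤s m<σ)))))

      aligned : ∃ λ t → Up t first first
      aligned with step first
      ... | inj₂ (_ , _ , u) = ⊥-elim (not-down u)
      ... | inj₁ (t , n , u) with up-first u
      ... | inj₁ refl = t , u
      ... | inj₂ refl = ⊥-elim (shifted first-positive)
        where
        shifted : ¬ (∃ λ b → first ≡ suc b)
        shifted (b , eq) = not-shifted {t} {b}
          (subst (λ a → d b ≢ d a) eq (turn eq))
          (subst (λ a → d a ≡ d (suc a)) eq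
            (trans (within z≤n) (sym (within (≤-trans (s≤s z≤n) 4≤k)))))
          (subst (λ a → d (2 + a) ≡ d (3 + a)) eq
            (trans (within (≤-trans (m≤n+m 2 2) 4≤k)) (sym (within (≤-trans (n≤1+n 3) 4≤k)))))
          (subst (λ a → Up t (suc a) a) eq u)

    -- Tails of copies, and how many of them can be disjoint.

    Tail : Index → Set
    Tail t = ∃ λ a → ∀ i → a ≤ i → p i ≡ ray t i

    tail : RepresentingSequenceUnbounded d → ¬ ¬ ∃ Tail
    tail unbounded no-tail with origin
      where
      origin : ∃₂ λ t x → p 0 ≡ ray t x
      origin with step 0
      ... | inj₁ (t , n , e , _) = t , n , e
      ... | inj₂ (t , n , e , _) = t , suc n , e
    -- Site number `suc x₀` is late enough for `x₀ < count σ`.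
    ... | t₀ , x₀ , e₀ = nth-site unbounded (suc x₀) λ { (σ , s , eq) →
      let (t , u) = AtSite.aligned s {t₀} {x₀} e₀ (≤-reflexive (sym eq)) in
      no-tail (t , Phase.first (phase (suc σ)) , λ i a≤i →
        subst (λ j → p j ≡ ray t j) (m∸n+n≡m a≤i) (follow-forever u (i ∸ Phase.first (phase (suc σ))))) }

  open Follow using (Tail; tail)

  module _ (unbounded : RepresentingSequenceUnbounded d) where

    clash-meet : ∀ {u t} (P Q : Copy (OrientedRay d) Host) → Tail P u → Tail Q t → Clash u t →
      ¬ (∀ x y → map P x ≢ map Q y)
    clash-meet {u} {t} P Q (a , h) (b , h′) cl disjoint with indexPair-recurs u t (a + b)
    -- Since `a + b ≤ s` and `s = count σ ≤ σ`, both copies have reached their tails at the shared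
    -- vertex.
    ... | s , ab≤s , e = nth-site unbounded s λ { (σ , site , refl) →
      let σ≥ = ≤-trans ab≤s (count≤ σ)
          m = site , e , cl
      in disjoint σ (suc σ) (trans (h σ (m+n≤o⇒m≤o a σ≥))
           (trans (ray-lower m) (trans (sym (ray-merged m))
             (sym (h′ (suc σ) (m≤n⇒m≤1+n (m+n≤o⇒n≤o a σ≥))))))) }

    same-meet : ∀ {t} (P Q : Copy (OrientedRay d) Host) → Tail P t → Tail Q t →
      ¬ (∀ x y → map P x ≢ map Q y)
    same-meet P Q (a , h) (b , h′) disjoint =
      disjoint (a + b) (a + b) (trans (h _ (m≤m+n a b)) (sym (h′ _ (m≤n+m b a))))

    ¬infinitelyMany : ¬ HasInfinitelyManyDisjointCopies (OrientedRay d) Host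
    ¬infinitelyMany (F , disjoint) = tail (F 0) unbounded λ { ((k , i₀) , T₀) →
      -- Once `k` is known, `suc k` further tails suffice, one more than the block has rays.
      ¬¬-Π-Fin {suc k} (λ i → tail (F (suc (toℕ i))) unbounded) (crowded k i₀ T₀) }
      where
      crowded : ∀ k i₀ → Tail (F 0) (k , i₀) →
        ¬ (∀ (i : Fin (suc k)) → ∃ (Tail (F (suc (toℕ i)))))
      crowded k i₀ T₀ tails = collide (pigeonhole ≤-refl λ i → fromℕ< (proj₂ (peer i)))
        where
        t : Fin (suc k) → Index
        t i = proj₁ (tails i)
        t₀≢ : ∀ i → (k , i₀) ≢ t i
        t₀≢ i eq = same-meet (F 0) (F (suc (toℕ i))) T₀
          (subst (Tail (F (suc (toℕ i)))) (sym eq) (proj₂ (tails i))) (disjoint 0 _ λ ())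
        peer : ∀ i → k ≡ proj₁ (t i) × proj₂ (t i) < k
        peer i with (k ≟ proj₁ (t i)) ×-dec ((i₀ <? k) ×-dec (proj₂ (t i) <? proj₁ (t i)))
        ... | yes (e , _ , h) = e , subst (proj₂ (t i) <_) (sym e) h
        ... | no h = ⊥-elim (clash-meet (F 0) (F (suc (toℕ i))) T₀ (proj₂ (tails i)) (t₀≢ i , h)
                (disjoint 0 _ λ ()))
        collide : ¬ (∃₂ λ i j → i <ᶠ j ×
          fromℕ< (proj₂ (peer i)) ≡ fromℕ< (proj₂ (peer j)))
        collide (i , j , i<j , eq) = same-meet (F (suc (toℕ i))) (F (suc (toℕ j)))
          (subst (Tail (F (suc (toℕ i)))) ti≡tj (proj₂ (tails i))) (proj₂ (tails j))
          (disjoint _ _ λ e → <⇒≢ i<j (cong pred e))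
          where
          ti≡tj : t i ≡ t j
          ti≡tj = cong₂ _,_ (trans (sym (proj₁ (peer i))) (proj₁ (peer j)))
            (fromℕ<-injective _ _ (proj₂ (peer i)) (proj₂ (peer j)) eq)

theorem4p4 : (d : ℕ → Bool) → InfinitelyManyIn d → InfinitelyManyOut d →
    RepresentingSequenceUnbounded d → ¬ Ubiquitous (OrientedRay d)
theorem4p4 d _ _ unbounded ubiquitous = ¬infinitelyMany unbounded (ubiquitous Host manyCopies)
  where open Construction d
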